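{- Every tree $T$ with $n$ vertices has a monotone drawing on a grid of size at most $12n\times 12n$; that is, $T$ has a monotone drawing in which all vertices are placed at points with integer coordinates and which is contained in an axis-parallel rectangle with integer corner coordinates, of width at most $12n$ and height at most $12n$.
   Context: A straight-line drawing of a tree $T$ assigns to its vertices distinct points of the plane and draws each edge as the line segment connecting the points of its two end vertices, without any edge crossing. A path $P=(u_1,\dots,u_k)$ in a straight-line drawing is monotone with respect to a direction $l$ (a half-line, equivalently a nonzero vector) if the orthogonal projections of $u_1,\dots,u_k$ on $l$ appear along $l$ in the (strict) order in which they appear along the path; $P$ is monotone if it is monotone with respect to some direction. A straight-line drawing of $T$ is a monotone drawing if for every pair of vertices $u,w$ the path of $T$ between $u$ and $w$ is monotone (the direction may depend on the pair). -}

module Defs where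

open import Data.Nat as ℕ using (ℕ)
open import Data.Integer as ℤ using (ℤ; +_)
open import Data.Rational using (ℚ; 0ℚ; 1ℚ; _+_; _*_; _-_; _/_; _≤_; _<_)
open import Data.Fin using (Fin)
open import Data.List using (List; head; last; length)
open import Data.List.Relation.Unary.Linked using (Linked)
open import Data.List.Relation.Unary.AllPairs using (AllPairs)
open import Data.List.Relation.Unary.Unique.Propositional using (Unique)
open import Data.Maybe using (just)
open import Data.Product using (∃; ∃-syntax; _×_; _,_; proj₁; proj₂)
open import Data.Sum using (_⊎_)
open import Relation.Binary using (Symmetric; Irreflexive; Decidable)
open import Relation.Binary.PropositionalEquality using (_≡_; _≢_)
open import Relation.Nullary using (¬_)

record Graph (n : ℕ) : Set₁ where
  field
    Adj     : Fin n → Fin n → Set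
    adj?    : Decidable Adj
    symm    : Symmetric Adj
    irrefl  : Irreflexive _≡_ Adj

module _ {n : ℕ} (G : Graph n) where
  open Graph G

  record IsPath (u w : Fin n) (p : List (Fin n)) : Set where
    field
      starts : head p ≡ just u
      ends   : last p ≡ just w
      linked : Linked Adj p
      simple : Unique p

  Connected : Set
  Connected = ∀ u w → ∃[ p ] IsPath u w p

  -- A cycle is a path on at least three vertices whose ends are adjacent.
  Acyclic : Set
  Acyclic = ∀ {u w p} → IsPath u w p → 3 ℕ.≤ length p → ¬ Adj w u

record Tree (n : ℕ) : Set₁ where
  field
    graph     : Graph n
    nonEmpty  : ℕ.NonZero n
    connected : Connected graph
    acyclic   : Acyclic graph
  open Graph graph public

-- Points, directions and segment parameters are rational. For drawings
-- with integer vertices this agrees with the real plane: a direction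
-- for which finitely many strict inequalities hold can be perturbed to
-- a rational one, and two segments with integer ends that meet in a
-- real point outside a finite set of rational points also meet in a
-- rational point outside that set.

Point : Set
Point = ℚ × ℚ

Vector : Set
Vector = ℚ × ℚ

-- The orthogonal projection of p on the line spanned by d is
-- (⟨ p , d ⟩ / ⟨ d , d ⟩) d, so along d ≠ 0 the projections are ordered
-- as the numbers ⟨ p , d ⟩.
⟨_∣_⟩ : Point → Vector → ℚ
⟨ (x , y) ∣ (a , b) ⟩ = x * a + y * b

_∈[_,_] : Point → Point → Point → Set
X ∈[ (x₀ , y₀) , (x₁ , y₁) ] =
  ∃[ t ] 0ℚ ≤ t × t ≤ 1ℚ ×
    X ≡ ((1ℚ - t) * x₀ + t * x₁ , (1ℚ - t) * y₀ + t * y₁)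

fromℤ : ℤ → ℚ
fromℤ z = z / 1

IsInteger : ℚ → Set
IsInteger q = ∃[ z ] q ≡ fromℤ z

record Rectangle : Set where
  field
    left right bottom top : ℤ

  width height : ℤ
  width  = right ℤ.- left
  height = top ℤ.- bottom

_∈ᴿ_ : Point → Rectangle → Set
(x , y) ∈ᴿ R =
  (fromℤ left ≤ x × x ≤ fromℤ right) × (fromℤ bottom ≤ y × y ≤ fromℤ top)
  where open Rectangle R

module _ {n : ℕ} (T : Tree n) where
  open Tree T

  -- Since every vertex of a tree on at least two vertices lies on an
  -- edge, noCrossing also keeps edges from passing through vertices
  -- other than their ends.
  record Drawing : Set where
    field
      pos        : Fin n → Point
      distinct   : ∀ {u v} → pos u ≡ pos v → u ≡ v
      noCrossing : ∀ {u v x y X} → Adj u v → Adj x y →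
                   X ∈[ pos u , pos v ] → X ∈[ pos x , pos y ] →
                   ((u ≡ x × v ≡ y) ⊎ (u ≡ y × v ≡ x)) ⊎
                   (∃[ z ] (z ≡ u ⊎ z ≡ v) × (z ≡ x ⊎ z ≡ y) × X ≡ pos z)

  module _ (D : Drawing) where
    open Drawing D

    MonotoneWrt : Vector → List (Fin n) → Set
    MonotoneWrt d = AllPairs (λ u v → ⟨ pos u ∣ d ⟩ < ⟨ pos v ∣ d ⟩)

    MonotonePath : List (Fin n) → Set
    MonotonePath p = ∃[ d ] d ≢ (0ℚ , 0ℚ) × MonotoneWrt d p

    IsMonotone : Set
    IsMonotone = ∀ {u w p} → IsPath graph u w p → MonotonePath p

    OnGrid : Set
    OnGrid = ∀ u → IsInteger (proj₁ (pos u)) × IsInteger (proj₂ (pos u))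

    _OnDrawing : Point → Set
    X OnDrawing = (∃[ u ] X ≡ pos u) ⊎
                  (∃[ u ] ∃[ v ] Adj u v × X ∈[ pos u , pos v ])

    ContainedIn : Rectangle → Set
    ContainedIn R = ∀ {X} → X OnDrawing → X ∈ᴿ R

{-# OPTIONS --safe #-}
module Submission where

-- Root the tree and give each vertex v an interval of slopes in (0 , 1), of
-- length φ(v); the edge from the parent of v to v, and all edges below v, get
-- slopes in it. The interval of v is split among its children in proportion to
-- the sizes s of their subtrees, so φ(c) = φ(v) s(c) / (s(v) - 1). A path of the
-- tree climbs towards the root and then descends into a sibling subtree; a line
-- whose slope separates the two sibling intervals is perpendicular to a direction
-- in which the path is monotone. The interval of v contains a fraction with
-- denominator at most 1 / φ(v) + 1 ≤ 2 / φ(v), and with this choice of φ these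
-- denominators sum to at most 2n along every descending path. Crossings are
-- excluded by monotonicity: any two edges lie on a common path of the tree.

open import Defs
open import Data.Nat as ℕ using (ℕ; _*_)
import Data.Nat.Properties as ℕ
open import Data.Nat.DivMod using (m≡m%n+[m/n]*n; m%n<n; m/n*n≤m)
import Data.Nat.Tactic.RingSolver as ℕ
open import Data.Fin as Fin using (Fin)
open import Data.Fin.Properties using (_≟_; _<?_; any?; <-cmp)
open import Data.Integer as ℤ using (ℤ; +_)
import Data.Integer.Properties as ℤ
import Data.Integer.Tactic.RingSolver as ℤ
open import Data.Rational as ℚ using (ℚ; 0ℚ; 1ℚ)
import Data.Rational.Properties as ℚ
open import Data.Rational.Solver using (module +-*-Solver)
open import Data.Rational.Unnormalised as ℚᵘ using (mkℚᵘ; *<*; *≤*)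
import Data.Rational.Unnormalised.Properties as ℚᵘ
open import Data.List using (List; []; _∷_; _++_; _∷ʳ_; head; last; length; filter; allFin; drop)
open import Data.List.Properties
  using (++-assoc; ∷-injectiveˡ; ∷-injectiveʳ; ++-cancelʳ; ∷ʳ-injectiveʳ; ≡-dec; length-filter; length-tabulate)
open import Data.List.Membership.Propositional using (_∈_; _∉_)
import Data.List.Membership.DecPropositional as DecMembership
open import Data.List.Membership.Propositional.Properties using (∈-allFin; ∈-++⁺ˡ; ∈-++⁺ʳ)
open import Data.List.Relation.Unary.Any using (here; there)
open import Data.List.Relation.Unary.All as All using ()
open import Data.List.Relation.Unary.All.Properties using (¬Any⇒All¬; All¬⇒¬Any)
open import Data.List.Relation.Unary.AllPairs using (AllPairs; []; _∷_)
open import Data.List.Relation.Unary.Linked as Linked using (Linked; []; [-]; _∷_)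
open import Data.List.Relation.Unary.Linked.Properties using (Linked⇒AllPairs)
open import Data.List.Relation.Unary.Unique.Propositional using (Unique)
open import Data.Maybe using (just)
open import Data.Product using (∃-syntax; _×_; _,_; proj₁; proj₂)
open import Data.Sum using (_⊎_; inj₁; inj₂)
open import Function using (_∘_; id; flip)
open import Relation.Binary.Definitions using (Tri; tri<; tri≈; tri>)
open import Relation.Binary.PropositionalEquality
open import Relation.Nullary using (Dec; ¬_; yes; no; contradiction)
open import Relation.Nullary.Decidable using (_×-dec_; _⊎-dec_)
open import Relation.Unary using (Decidable)

-- Paths in a tree and their uniqueness.

module Paths {n : ℕ} (T : Tree n) where
  open Tree T
  open DecMembership (_≟_ {n}) using (_∈?_)

  -- An inductive form of `IsPath`, so that proofs can recurse along a path while start, end and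
  -- simplicity stay at hand.
  data Path : Fin n → Fin n → List (Fin n) → Set where
    stop : ∀ {u} → Path u u (u ∷ [])
    step : ∀ {u v w p} → Adj u v → Path v w p → u ∉ p → Path u w (u ∷ p)

  start∈ : ∀ {u w p} → Path u w p → u ∈ p
  start∈ stop         = here refl
  start∈ (step _ _ _) = here refl

  path-head : ∀ {u w x p} → Path u w (x ∷ p) → x ≡ u
  path-head stop         = refl
  path-head (step _ _ _) = refl

  path-cons : ∀ {u w p} → Path u w p → ∃[ q ] p ≡ u ∷ q
  path-cons stop         = _ , refl
  path-cons (step _ _ _) = _ , refl

  path-snoc : ∀ {u w p} → Path u w p → ∃[ q ] p ≡ q ∷ʳ w
  path-snoc stop         = [] , refl
  path-snoc (step _ π _) with q , refl ← path-snoc π = _ ∷ q , refl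

  end∈ : ∀ {u w p} → Path u w p → w ∈ p
  end∈ stop         = here refl
  end∈ (step _ ρ _) = there (end∈ ρ)

  path-head∉ : ∀ {u w x p} → Path u w (x ∷ p) → x ∉ p
  path-head∉ stop          = λ ()
  path-head∉ (step _ _ u∉) = u∉

  path-linked : ∀ {u w p} → Path u w p → Linked Adj p
  path-linked stop                      = [-]
  path-linked (step a stop _)           = a ∷ [-]
  path-linked (step a π@(step _ _ _) _) = a ∷ path-linked π

  fromIsPath : ∀ {u w p} → IsPath graph u w p → Path u w p
  fromIsPath record { starts = s ; ends = e ; linked = l ; simple = un } = build _ s e l un
    where
    build : ∀ {u w} p → head p ≡ just u → last p ≡ just w → Linked Adj p → Unique p → Path u w p
    build (u ∷ [])    refl refl _       _         = stop
    build (u ∷ v ∷ p) refl e    (a ∷ l) (u∉ ∷ un) = step a (build (v ∷ p) refl e l un) (All¬⇒¬Any u∉)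

  toIsPath : ∀ {u w p} → Path u w p → IsPath graph u w p
  toIsPath π = record { starts = starts π ; ends = ends π ; linked = path-linked π ; simple = simple π }
    where
    starts : ∀ {u w p} → Path u w p → head p ≡ just u
    starts stop         = refl
    starts (step _ _ _) = refl

    ends : ∀ {u w p} → Path u w p → last p ≡ just w
    ends stop                      = refl
    ends (step _ stop _)           = refl
    ends (step _ π@(step _ _ _) _) = ends π

    simple : ∀ {u w p} → Path u w p → Unique p
    simple stop          = All.[] ∷ []
    simple (step _ π u∉) = ¬Any⇒All¬ _ u∉ ∷ simple π

  path : ∀ u w → ∃[ p ] Path u w p
  path u w with p , π ← connected u w = p , fromIsPath π

  _◅ʳ_ : ∀ {u w x p} → Path u w p → Adj w x × x ∉ p → Path u x (p ∷ʳ x)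
  stop         ◅ʳ (a , x∉) = step a stop λ { (here refl) → x∉ (here refl) }
  step b π u∉  ◅ʳ (a , x∉) = step b (π ◅ʳ (a , x∉ ∘ there)) (∉-∷ʳ _ u∉ λ { refl → x∉ (here refl) })
    where
    ∉-∷ʳ : ∀ {u x} p → u ∉ p → u ≢ x → u ∉ p ∷ʳ x
    ∉-∷ʳ []      _  u≢x (here u≡x) = u≢x u≡x
    ∉-∷ʳ (y ∷ p) u∉ _   (here u≡y) = u∉ (here u≡y)
    ∉-∷ʳ (y ∷ p) u∉ u≢x (there i)  = ∉-∷ʳ p (u∉ ∘ there) u≢x i

  prefix : ∀ {u v w p} → Path u w p → v ∈ p → ∃[ q ] ∃[ r ] p ≡ q ++ r × Path u v q
  prefix stop            (here refl) = _ , [] , refl , stop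
  prefix (step _ _ _)    (here refl) = _ , _ , refl , stop
  prefix (step a π u∉)   (there i) with q , r , refl , ρ ← prefix π i =
    _ , r , refl , step a ρ (u∉ ∘ ∈-++⁺ˡ)

  suffix : ∀ {u v w p} → Path u w p → v ∈ p → ∃[ q ] ∃[ r ] p ≡ q ++ r × Path v w r
  suffix stop           (here refl) = [] , _ , refl , stop
  suffix π@(step _ _ _) (here refl) = [] , _ , refl , π
  suffix (step _ π _)   (there i) with q , r , refl , ρ ← suffix π i = _ ∷ q , r , refl , ρ

  -- Any longer path between adjacent vertices would be closed to a cycle by their edge.
  edge-path : ∀ {u v p} → Adj u v → Path u v p → p ≡ u ∷ v ∷ []
  edge-path a stop                                 = contradiction a (irrefl refl)
  edge-path a (step _ stop _)                      = refl
  edge-path a π@(step _ (step _ stop _) _)         =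
    contradiction (symm a) (acyclic (toIsPath π) (ℕ.s≤s (ℕ.s≤s (ℕ.s≤s ℕ.z≤n))))
  edge-path a π@(step _ (step _ (step _ _ _) _) _) =
    contradiction (symm a) (acyclic (toIsPath π) (ℕ.s≤s (ℕ.s≤s (ℕ.s≤s ℕ.z≤n))))

  -- If `v` lies on the path, the initial part from `u` to `v` has adjacent ends, so it is the edge
  -- itself; otherwise `v` can be prepended.
  extendˡ : ∀ {u v w p} → Path u w p → Adj u v →
            (∃[ q ] p ≡ u ∷ v ∷ q) ⊎ Path v w (v ∷ p)
  extendˡ {v = v} {p = p} π a with v ∈? p
  ... | no v∉ = inj₂ (step (symm a) π v∉)
  ... | yes i with q , r , refl , ρ ← prefix π i with refl ← edge-path a ρ = inj₁ (r , refl)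

  extendʳ : ∀ {u w x p} → Path u w p → Adj w x →
            (∃[ q ] p ≡ q ++ x ∷ w ∷ []) ⊎ Path u x (p ∷ʳ x)
  extendʳ {x = x} {p = p} π a with x ∈? p
  ... | no x∉ = inj₂ (π ◅ʳ (a , x∉))
  ... | yes i with q , r , refl , ρ ← suffix π i with refl ← edge-path (symm a) ρ = inj₁ (q , refl)

  -- If the second vertices differ then u prepended to the rest of the other
  -- path is again a path, equal by induction to one that avoids u.
  path-unique : ∀ {u w p q} → Path u w p → Path u w q → p ≡ q
  path-unique stop stop = refl
  path-unique stop (step _ ρ u∉) = contradiction (end∈ ρ) u∉
  path-unique (step a π u∉) ρ with extendˡ ρ a
  ... | inj₂ ρ′ = contradiction (subst (_ ∈_) (sym (path-unique π ρ′)) (there (start∈ ρ))) u∉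
  path-unique (step a π u∉) (step b ρ _) | inj₁ (q , refl) with refl ← path-head ρ =
    cong (_ ∷_) (path-unique π ρ)
  path-unique (step a π u∉) stop | inj₁ (q , ())

-- Counting the elements of a list that satisfy a decidable predicate.

module Counting where
  open import Data.Nat
  open import Data.Nat.Properties

  module _ {A : Set} {P : A → Set} (P? : Decidable P) where

    count : List A → ℕ
    count = length ∘ filter P?

    count≤length : ∀ xs → count xs ≤ length xs
    count≤length = length-filter P?

    count-positive : ∀ {x xs} → x ∈ xs → P x → 0 < count xs
    count-positive {x} (here {xs = xs} refl) px with P? x
    ... | yes _ = z<s
    ... | no ¬px = contradiction px ¬px
    count-positive (there {x = y} i) px with P? y
    ... | yes _ = z<s
    ... | no _  = count-positive i px

  count-disjoint : {A : Set} {P Q R : A → Set} (P? : Decidable P) (Q? : Decidable Q) (R? : Decidable R) →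
                   (∀ {x} → P x → R x) → (∀ {x} → Q x → R x) → (∀ {x} → P x → ¬ Q x) →
                   ∀ xs → count P? xs + count Q? xs ≤ count R? xs
  count-disjoint P? Q? R? P⊆R Q⊆R P#Q [] = z≤n
  count-disjoint P? Q? R? P⊆R Q⊆R P#Q (x ∷ xs)
    with P? x | Q? x | R? x | count-disjoint P? Q? R? P⊆R Q⊆R P#Q xs
  ... | yes p | yes q | _     | _  = contradiction q (P#Q p)
  ... | yes p | no _  | yes _ | ih = s≤s ih
  ... | yes p | no _  | no ¬r | _  = contradiction (P⊆R p) ¬r
  ... | no _  | yes q | yes _ | ih = ≤-trans (≤-reflexive (+-suc _ _)) (s≤s ih)
  ... | no _  | yes q | no ¬r | _  = contradiction (Q⊆R q) ¬r
  ... | no _  | no _  | yes _ | ih = m≤n⇒m≤1+n ih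
  ... | no _  | no _  | no _  | ih = ih

-- Ranges of slopes, fractions in them and the cost of those fractions.

module Slopes where
  open import Data.Nat
  open import Data.Nat.Properties

  m∸1*n+n≡m*n : ∀ {m} n → 0 < m → (m ∸ 1) * n + n ≡ m * n
  m∸1*n+n≡m*n {suc m} n _ = +-comm (m * n) n

  -- The junk value m ÷ 0 = 0 keeps side conditions out of the definition of the drawing.
  infixl 7 _÷_
  _÷_ : ℕ → ℕ → ℕ
  m ÷ zero    = 0
  m ÷ n@(suc _) = m / n

  ÷-lower : ∀ m {n} → n * (m ÷ n) ≤ m
  ÷-lower m {zero}  = z≤n
  ÷-lower m {n@(suc _)} = ≤-trans (≤-reflexive (*-comm n (m / n))) (m/n*n≤m m n)

  ÷-upper : ∀ m {n} → 0 < n → m < n * suc (m ÷ n)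
  ÷-upper m {n@(suc _)} _ = begin-strict
    m                   ≡⟨ m≡m%n+[m/n]*n m n ⟩
    m % n + m / n * n   <⟨ +-monoˡ-< (m / n * n) (m%n<n m n) ⟩
    n + m / n * n       ≡⟨ *-comm (suc (m / n)) n ⟩
    n * suc (m / n)     ∎
    where open ≤-Reasoning

  -- The open interval of slopes from lo / scale to (lo + width) / scale.
  record Range : Set where
    constructor range
    field
      lo width scale : ℕ

  open Range

  Edge : Set
  Edge = ℕ × ℕ

  Steeper Flatter : ℕ → ℕ → Edge → Set
  Steeper p q (x , y) = p * x < q * y
  Flatter p q (x , y) = q * y < p * x

  _∋_ : Range → Edge → Set
  R ∋ e = Steeper (lo R) (scale R) e × Flatter (lo R + width R) (scale R) e

  Valid : Range → Set
  Valid R = 0 < width R × lo R + width R ≤ scale R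

  unitRange : Range
  unitRange = range 0 1 1

  unitRange-valid : Valid unitRange
  unitRange-valid = z<s , ≤-refl

  scale-positive : ∀ R → Valid R → 0 < scale R
  scale-positive R (w>0 , ≤s) = ≤-trans (≤-trans w>0 (m≤n+m (width R) (lo R))) ≤s

  -- Cuts the range into `k` equal cells, skips `o` of them and takes the next `s`; multiplying the
  -- scale by `k` keeps the ends integral.
  subrange : Range → ℕ → ℕ → ℕ → Range
  subrange (range l w N) k o s = range (l * k + w * o) (w * s) (N * k)

  -- The vector has slope `y / x`. In a valid range `x` is the least integer above `N / w`, and `y`
  -- the least that puts the slope beyond the lower end.
  edgeIn : Range → Edge
  edgeIn (range l w N) = x , suc ((l * x) ÷ N)
    where x = suc (N ÷ w)

  -- The multiples of 1/x are closer together than the range is long.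
  edgeIn-∋ : ∀ R → Valid R → R ∋ edgeIn R
  edgeIn-∋ R@(range l w N) v@(w>0 , _) = ÷-upper (l * x) (scale-positive R v) , (begin-strict
    N * suc (l * x ÷ N)     ≡⟨ *-suc N _ ⟩
    N + N * (l * x ÷ N)     ≤⟨ +-monoʳ-≤ N (÷-lower (l * x) {N}) ⟩
    N + l * x               <⟨ +-monoˡ-< (l * x) (÷-upper N w>0) ⟩
    w * x + l * x           ≡⟨ +-comm (w * x) (l * x) ⟩
    l * x + w * x           ≡⟨ *-distribʳ-+ x l w ⟨
    (l + w) * x             ∎)
    where
    open ≤-Reasoning
    x = suc (N ÷ w)

  -- The rounding adds at most 1 to `N / w`, and `w ≤ N`, since the range lies within (0 , 1), lets
  -- a second `N / w` absorb it.
  edgeIn-cost : ∀ R → Valid R → proj₁ (edgeIn R) * width R ≤ 2 * scale R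
  edgeIn-cost R@(range l w N) (_ , l+w≤N) = begin
    suc (N ÷ w) * w     ≡⟨ *-comm (suc (N ÷ w)) w ⟩
    w * suc (N ÷ w)     ≡⟨ *-suc w _ ⟩
    w + w * (N ÷ w)     ≤⟨ +-mono-≤ (≤-trans (m≤n+m w l) l+w≤N) (÷-lower N {w}) ⟩
    N + N               ≡⟨ cong (λ t → N + t) (+-identityʳ N) ⟨
    2 * N               ∎
    where open ≤-Reasoning

  module _ {k o s : ℕ} (o+s≤k : o + s ≤ k) where

    private
      hi≤ : ∀ l w → l * k + w * o + w * s ≤ (l + w) * k
      hi≤ l w = begin
        l * k + w * o + w * s     ≡⟨ lemma l w k o s ⟩
        l * k + w * (o + s)       ≤⟨ +-monoʳ-≤ (l * k) (*-monoʳ-≤ w o+s≤k) ⟩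
        l * k + w * k             ≡⟨ *-distribʳ-+ k l w ⟨
        (l + w) * k               ∎
        where
        open ≤-Reasoning
        lemma : ∀ l w k o s → l * k + w * o + w * s ≡ l * k + w * (o + s)
        lemma = ℕ.solve-∀

    subrange-valid : ∀ R → Valid R → 0 < s → Valid (subrange R k o s)
    subrange-valid (range l w N) (w>0 , l+w≤N) s>0 =
      *-mono-< w>0 s>0 , ≤-trans (hi≤ l w) (*-monoˡ-≤ k l+w≤N)

    subrange-⊆ : ∀ R {e} → subrange R k o s ∋ e → R ∋ e
    subrange-⊆ (range l w N) {x , y} (lower , upper) =
      *-cancelʳ-< k (l * x) (N * y) (begin-strict
        l * x * k               ≡⟨ swap l x k ⟩
        l * k * x               ≤⟨ *-monoˡ-≤ x (m≤m+n (l * k) (w * o)) ⟩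
        (l * k + w * o) * x     <⟨ lower ⟩
        N * k * y               ≡⟨ swap N k y ⟩
        N * y * k               ∎) ,
      *-cancelʳ-< k (N * y) ((l + w) * x) (begin-strict
        N * y * k                       ≡⟨ swap N y k ⟩
        N * k * y                       <⟨ upper ⟩
        (l * k + w * o + w * s) * x     ≤⟨ *-monoˡ-≤ x (hi≤ l w) ⟩
        (l + w) * k * x                 ≡⟨ swap (l + w) k x ⟩
        (l + w) * x * k                 ∎)
      where
      open ≤-Reasoning
      swap : ∀ a b c → a * b * c ≡ a * c * b
      swap = ℕ.solve-∀

  -- Besides X this reserves 2 scale / width, the greatest cost of an edge in R, for
  -- each of the s - 1 proper descendants.
  Affordable : ℕ → Range → ℕ → ℕ → Set
  Affordable n R s X = X * width R + 2 * scale R * (s ∸ 1) ≤ 2 * n * width R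

  -- Let φ be the length of `R` and φ′ = φ s / k that of `R′`. The new edge and the new reserve
  -- together cost at most (2 / φ′) s = (2 / φ) k, which is exactly the reserve held before.
  subrange-affordable : ∀ {n s′ X o} R s → Valid (subrange R (s′ ∸ 1) o s) → 0 < s →
                        Affordable n R s′ X →
                        let R′ = subrange R (s′ ∸ 1) o s in
                        Affordable n R′ s (X + proj₁ (edgeIn R′))
  subrange-affordable {n} {s′} {X} {o} R@(range l w N) s v s>0 ok = begin
    (X + x) * (w * s) + 2 * (N * k) * (s ∸ 1)               ≡⟨ lemma₁ X x (w * s) (N * k) (s ∸ 1) ⟩
    X * (w * s) + (x * (w * s) + (s ∸ 1) * (2 * (N * k)))   ≤⟨ +-monoʳ-≤ (X * (w * s)) (+-monoˡ-≤ _ (edgeIn-cost R′ v)) ⟩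
    X * (w * s) + (2 * (N * k) + (s ∸ 1) * (2 * (N * k)))   ≡⟨ cong (λ t → X * (w * s) + t) (trans (+-comm (2 * (N * k)) _) (m∸1*n+n≡m*n _ s>0)) ⟩
    X * (w * s) + s * (2 * (N * k))                         ≡⟨ lemma₂ X w s N k ⟩
    (X * w + 2 * N * k) * s                                 ≤⟨ *-monoˡ-≤ s ok ⟩
    2 * n * w * s                                           ≡⟨ *-assoc (2 * n) w s ⟩
    2 * n * (w * s)                                         ∎
    where
    open ≤-Reasoning
    k = s′ ∸ 1
    R′ = subrange R k o s
    x = proj₁ (edgeIn R′)
    lemma₁ : ∀ X x W M t → (X + x) * W + 2 * M * t ≡ X * W + (x * W + t * (2 * M))
    lemma₁ = ℕ.solve-∀
    lemma₂ : ∀ X w s N k → X * (w * s) + s * (2 * (N * k)) ≡ (X * w + 2 * N * k) * s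
    lemma₂ = ℕ.solve-∀

  affordable-bound : ∀ {n s X} R → Valid R → Affordable n R s X → X ≤ 2 * n
  affordable-bound R@(range l w@(suc _) N) _ ok = *-cancelʳ-≤ _ _ w (≤-trans (m≤m+n _ _) ok)

i<j⇒0<j-i : ∀ {i j} → i ℤ.< j → ℤ.0ℤ ℤ.< j ℤ.- i
i<j⇒0<j-i {i} {j} i<j = subst (ℤ._< j ℤ.- i) (ℤ.+-inverseʳ i) (ℤ.+-monoˡ-< (ℤ.- i) i<j)

i<j⇒i-j<0 : ∀ {i j} → i ℤ.< j → i ℤ.- j ℤ.< ℤ.0ℤ
i<j⇒i-j<0 {i} {j} i<j = subst (i ℤ.- j ℤ.<_) (ℤ.+-inverseʳ j) (ℤ.+-monoˡ-< (ℤ.- j) i<j)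

-- Rooted trees: ancestors, children and subtrees.

module Rooted {n : ℕ} (T : Tree n) (r : Fin n) where
  open Tree T
  open Paths T
  open Counting
  open Slopes
  open Range
  open import Data.Nat hiding (_≟_; _<?_; <-cmp)
  open import Data.Nat.Properties hiding (_≟_; _<?_; <-cmp)
  open DecMembership (_≟_ {n}) using (_∈?_)

  -- The ancestors of `v`, listed from `v` up to the root. Thus `c ∈ anc v` says that `v` lies in
  -- the subtree of `c`.
  anc : Fin n → List (Fin n)
  anc v = proj₁ (path v r)

  anc-path : ∀ v → Path v r (anc v)
  anc-path v = proj₂ (path v r)

  anc-unique : ∀ {v p} → Path v r p → anc v ≡ p
  anc-unique = path-unique (anc-path _)

  anc-suffix : ∀ {c v} → c ∈ anc v → ∃[ q ] anc v ≡ q ++ anc c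
  anc-suffix {v = v} i with q , _ , eq , π ← suffix (anc-path v) i =
    q , trans eq (cong (q ++_) (sym (anc-unique π)))

  anc-trans : ∀ {a b c} → a ∈ anc b → b ∈ anc c → a ∈ anc c
  anc-trans i j with q , eq ← anc-suffix j = subst (_ ∈_) (sym eq) (∈-++⁺ʳ q i)

  ChildOf : Fin n → Fin n → Set
  ChildOf u c = anc c ≡ c ∷ anc u

  child-of-adj : ∀ {x y} → Adj x y → ChildOf x y ⊎ ChildOf y x
  child-of-adj {x} a with extendˡ (anc-path x) a
  ... | inj₂ π = inj₁ (anc-unique π)
  ... | inj₁ (q , eq) with step _ π _ ← subst (Path x r) eq (anc-path x) with refl ← path-head π =
    inj₂ (trans eq (cong (x ∷_) (sym (anc-unique π))))

  anc-head : ∀ u → ∃[ q ] anc u ≡ u ∷ q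
  anc-head u = path-cons (anc-path u)

  anc-injective : ∀ {u v} → anc u ≡ anc v → u ≡ v
  anc-injective {u} {v} eq with _ , eq₁ ← anc-head u | _ , eq₂ ← anc-head v =
    ∷-injectiveˡ (trans (sym eq₁) (trans eq eq₂))

  parent-unique : ∀ {u v c} → ChildOf u c → ChildOf v c → u ≡ v
  parent-unique cu cv = anc-injective (∷-injectiveʳ (trans (sym cu) cv))

  self∈ : ∀ u → u ∈ anc u
  self∈ u = start∈ (anc-path u)

  parent∈ : ∀ {u c} → ChildOf u c → u ∈ anc c
  parent∈ {u} cu = subst (u ∈_) (sym cu) (there (self∈ u))

  child∉ : ∀ {u c} → ChildOf u c → c ∉ anc u
  child∉ {u} {c} cu = path-head∉ (subst (Path c r) cu (anc-path c))

  -- Recursion along the path to the root. The base case receives the value of `anc r`, so that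
  -- functions of root paths can be evaluated there.
  rooted-induction : (P : Fin n → Set) → (anc r ≡ r ∷ [] → P r) →
                     (∀ {u c} → ChildOf u c → P u → P c) → ∀ v → P v
  rooted-induction P base up v = go (anc-path v)
    where
    go : ∀ {v p} → Path v r p → P v
    go stop = base (anc-unique stop)
    go π@(step _ ρ _) = up (trans (anc-unique π) (cong (_ ∷_) (sym (anc-unique ρ)))) (go ρ)

  -- In `anc v` both `b` and `c` stand immediately before the same tail `anc u`.
  siblings-disjoint : ∀ {u b c v} → ChildOf u b → ChildOf u c → b ∈ anc v → c ∈ anc v → b ≡ c
  siblings-disjoint {u} {b} {c} bu cu i j with q , eq ← anc-suffix i | q′ , eq′ ← anc-suffix j =
    ∷ʳ-injectiveʳ q q′ (++-cancelʳ (anc u) (q ∷ʳ b) (q′ ∷ʳ c) (begin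
      (q ∷ʳ b) ++ anc u     ≡⟨ ++-assoc q _ _ ⟩
      q ++ b ∷ anc u        ≡⟨ cong (q ++_) bu ⟨
      q ++ anc b            ≡⟨ trans (sym eq) eq′ ⟩
      q′ ++ anc c           ≡⟨ cong (q′ ++_) cu ⟩
      q′ ++ c ∷ anc u       ≡⟨ ++-assoc q′ _ _ ⟨
      (q′ ∷ʳ c) ++ anc u    ∎))
    where open ≡-Reasoning

  -- Subtree sizes and the room they need below a common parent.

  size : Fin n → ℕ
  size c = count (λ v → c ∈? anc v) (allFin n)

  size-positive : ∀ c → 0 < size c
  size-positive c = count-positive (λ v → c ∈? anc v) (∈-allFin c) (self∈ c)

  size≤n : ∀ c → size c ≤ n
  size≤n c = ≤-trans (count≤length (λ v → c ∈? anc v) (allFin n)) (≤-reflexive (length-tabulate id))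

  -- Siblings are recognised by equal tails of their root paths, a decidable condition that does not
  -- mention the parent.
  BelowEarlierSibling : Fin n → Fin n → Set
  BelowEarlierSibling c v = ∃[ b ] b Fin.< c × drop 1 (anc b) ≡ drop 1 (anc c) × b ∈ anc v

  below? : ∀ c v → Dec (BelowEarlierSibling c v)
  below? c v = any? λ b → b <? c ×-dec ≡-dec _≟_ _ _ ×-dec b ∈? anc v

  -- The total size of the subtrees of earlier siblings, obtained as one count of vertices instead
  -- of a sum over children.
  offset : Fin n → ℕ
  offset c = count (below? c) (allFin n)

  sibling : ∀ {u b c} → ChildOf u c → drop 1 (anc b) ≡ drop 1 (anc c) → ChildOf u b
  sibling {b = b} cu eq with _ , eqb ← anc-head b =
    trans eqb (cong (b ∷_) (trans (sym (cong (drop 1) eqb)) (trans eq (cong (drop 1) cu))))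

  below-disjoint : ∀ {u c v} → ChildOf u c → BelowEarlierSibling c v → c ∉ anc v
  below-disjoint cu (b , b<c , eq , i) j =
    <⇒≢ b<c (cong Fin.toℕ (siblings-disjoint (sibling cu eq) cu i j))

  offset-mono : ∀ {u b c} → ChildOf u b → ChildOf u c → b Fin.< c → offset b + size b ≤ offset c
  offset-mono {u} {b} {c} bu cu b<c =
    count-disjoint (below? b) (λ v → b ∈? anc v) (below? c)
      (λ (a , a<b , eq , i) → a , <-trans a<b b<c , trans eq b~c , i)
      (λ i → b , b<c , b~c , i)
      (below-disjoint bu) (allFin n)
    where
    b~c : drop 1 (anc b) ≡ drop 1 (anc c)
    b~c = trans (cong (drop 1) bu) (sym (cong (drop 1) cu))

  -- All vertices counted on the left are proper descendants of `u`. Counting `u` as well makes the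
  -- inequality with `size u` strict, which pays for the subtracted 1.
  offset+size≤ : ∀ {u c} → ChildOf u c → offset c + size c ≤ size u ∸ 1
  offset+size≤ {u} {c} cu = ∸-monoˡ-≤ 1 (begin-strict
    offset c + size c                         ≤⟨ count-disjoint (below? c) (λ v → c ∈? anc v) strictly? inj₁ inj₂
                                                   (below-disjoint cu) vs ⟩
    count strictly? vs                        <⟨ m<m+n _ (count-positive (_≟ u) (∈-allFin u) refl) ⟩
    count strictly? vs + count (_≟ u) vs      ≤⟨ count-disjoint strictly? (_≟ u) (λ v → u ∈? anc v)
                                                   below-u (λ { refl → self∈ u }) (λ { s refl → not-u s }) vs ⟩
    size u                                    ∎)
    where
    open ≤-Reasoning
    vs = allFin n

    Strictly : Fin n → Set
    Strictly v = BelowEarlierSibling c v ⊎ c ∈ anc v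

    strictly? : ∀ v → Dec (Strictly v)
    strictly? v = below? c v ⊎-dec c ∈? anc v

    below-u : ∀ {v} → Strictly v → u ∈ anc v
    below-u (inj₁ (b , _ , eq , i)) = anc-trans (parent∈ (sibling cu eq)) i
    below-u (inj₂ i)                = anc-trans (parent∈ cu) i

    not-u : ¬ Strictly u
    not-u (inj₁ (b , _ , eq , i)) = child∉ (sibling cu eq) i
    not-u (inj₂ i)                = child∉ cu i

  -- Ranges, edge vectors and coordinates of the vertices.

  rangeAt : List (Fin n) → Range
  -- There is one cell for each proper descendant of `u`, and `c` gets as many as its subtree has
  -- vertices.
  rangeAt (c ∷ p@(u ∷ _)) = subrange (rangeAt p) (size u ∸ 1) (offset c) (size c)
  rangeAt _               = unitRange

  rangeOf : Fin n → Range
  rangeOf v = rangeAt (anc v)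

  -- The vector from the parent of v to v; edge r is a junk value.
  edge : Fin n → Edge
  edge v = edgeIn (rangeOf v)

  coordinateAt : (Edge → ℕ) → List (Fin n) → ℕ
  coordinateAt π (c ∷ p@(_ ∷ _)) = coordinateAt π p + π (edge c)
  coordinateAt π _               = 0

  X Y : Fin n → ℕ
  X v = coordinateAt proj₁ (anc v)
  Y v = coordinateAt proj₂ (anc v)

  -- `rangeAt` unfolds only when the second entry of the list is visible, so the head of `anc u` is
  -- exposed first and folded back afterwards.
  range-child : ∀ {u c} → ChildOf u c → rangeOf c ≡ subrange (rangeOf u) (size u ∸ 1) (offset c) (size c)
  range-child {u} {c} cu with q , eq ← anc-head u = begin
    rangeAt (anc c)                                             ≡⟨ cong rangeAt (trans cu (cong (c ∷_) eq)) ⟩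
    subrange (rangeAt (u ∷ q)) (size u ∸ 1) (offset c) (size c) ≡⟨ cong (λ p → subrange (rangeAt p) (size u ∸ 1) (offset c) (size c)) eq ⟨
    subrange (rangeAt (anc u)) (size u ∸ 1) (offset c) (size c) ∎
    where open ≡-Reasoning

  coordinate-child : ∀ π {u c} → ChildOf u c →
                     coordinateAt π (anc c) ≡ coordinateAt π (anc u) + π (edge c)
  coordinate-child π {u} {c} cu with q , eq ← anc-head u = begin
    coordinateAt π (anc c)                   ≡⟨ cong (coordinateAt π) (trans cu (cong (c ∷_) eq)) ⟩
    coordinateAt π (u ∷ q) + π (edge c)      ≡⟨ cong (λ p → coordinateAt π p + π (edge c)) eq ⟨
    coordinateAt π (anc u) + π (edge c)      ∎
    where open ≡-Reasoning

  range-valid : ∀ v → Valid (rangeOf v)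
  range-valid = rooted-induction _
    (λ eq → subst (Valid ∘ rangeAt) (sym eq) unitRange-valid)
    (λ {u} {c} cu ok → subst Valid (sym (range-child cu))
      (subrange-valid (offset+size≤ cu) (rangeOf u) ok (size-positive c)))

  range-⊆ : ∀ v {a e} → a ∈ anc v → rangeOf v ∋ e → rangeOf a ∋ e
  range-⊆ v {a} {e} = rooted-induction (λ v → a ∈ anc v → rangeOf v ∋ e → rangeOf a ∋ e)
    (λ eq i ∋e → subst (λ v → rangeOf v ∋ e) (only (subst (a ∈_) eq i)) ∋e)
    up v
    where
    only : ∀ {u} → a ∈ u ∷ [] → u ≡ a
    only (here refl) = refl

    up : ∀ {u c} → ChildOf u c → (a ∈ anc u → rangeOf u ∋ e → rangeOf a ∋ e) →
         a ∈ anc c → rangeOf c ∋ e → rangeOf a ∋ e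
    up {u} cu ih i ∋e with subst (a ∈_) cu i
    ... | here refl = ∋e
    ... | there j   = ih j (subrange-⊆ (offset+size≤ cu) (rangeOf u) (subst (_∋ e) (range-child cu) ∋e))

  -- Ranges are nested along root paths, so the range of `a` controls the edge into `a` and all
  -- edges below it.
  edge-∋ : ∀ {a v} → a ∈ anc v → rangeOf a ∋ edge v
  edge-∋ {v = v} i = range-⊆ v i (edgeIn-∋ (rangeOf v) (range-valid v))

  -- The range of the root is (0 , 1), so all slopes are below 1. This makes a bound on `X` suffice
  -- for `Y`.
  edge-flat : ∀ v → proj₂ (edge v) < proj₁ (edge v)
  edge-flat v = subst₂ _<_ (*-identityˡ _) (*-identityˡ _) (proj₂ (subst (_∋ edge v) root-range (edge-∋ (root∈ v))))
    where
    root-range : rangeOf r ≡ unitRange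
    root-range = cong rangeAt (anc-unique stop)

    root∈ : ∀ v → r ∈ anc v
    root∈ = rooted-induction _ (λ _ → self∈ r) (λ cu i → subst (r ∈_) (sym cu) (there i))

  Y≤X : ∀ v → Y v ≤ X v
  Y≤X = rooted-induction _
    (λ eq → ≤-reflexive (trans (cong (coordinateAt proj₂) eq) (cong (coordinateAt proj₁) (sym eq))))
    (λ {u} {c} cu ih → subst₂ _≤_ (sym (coordinate-child proj₂ cu)) (sym (coordinate-child proj₁ cu))
      (+-mono-≤ ih (<⇒≤ (edge-flat c))))

  X-affordable : ∀ v → Affordable n (rangeOf v) (size v) (X v)
  X-affordable = rooted-induction _ base up
    where
    open ≤-Reasoning
    base : anc r ≡ r ∷ [] → Affordable n (rangeOf r) (size r) (X r)
    base eq = subst (λ p → Affordable n (rangeAt p) (size r) (coordinateAt proj₁ p)) (sym eq) (begin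
      -- At the root nothing has been spent, and the range has length 1, so only the reserve has to
      -- fit.
      2 * (size r ∸ 1)    ≤⟨ *-monoʳ-≤ 2 (≤-trans (m∸n≤m (size r) 1) (size≤n r)) ⟩
      2 * n               ≡⟨ *-identityʳ (2 * n) ⟨
      2 * n * 1           ∎)

    up : ∀ {u c} → ChildOf u c → Affordable n (rangeOf u) (size u) (X u) → Affordable n (rangeOf c) (size c) (X c)
    up {u} {c} cu ih =
      subst₂ (λ R X → Affordable n R (size c) X) (sym eq)
        (sym (trans (coordinate-child proj₁ cu) (cong (λ R → X u + proj₁ (edgeIn R)) eq)))
        (subrange-affordable {n = n} {s′ = size u} {X = X u} (rangeOf u) (size c)
          (subst Valid eq (range-valid c)) (size-positive c) ih)
      where eq = range-child cu

  X≤2n : ∀ v → X v ≤ 2 * n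
  X≤2n v = affordable-bound {n = n} {s = size v} (rangeOf v) (range-valid v) (X-affordable v)

  -- Separating slopes and the levels normal to them.

  Separated : Fin n → Fin n → Set
  Separated b c = ∃[ p ] ∃[ q ] 0 < q × (∀ v → b ∈ anc v → Flatter p q (edge v))
                                      × (∀ v → c ∈ anc v → Steeper p q (edge v))

  -- The lower end of the range of `c` is the separating slope. Ranges of siblings have the same
  -- scale, so their ends compare as integers, and `offset-mono` puts the range of `b` below.
  siblings-separated : ∀ {u b c} → ChildOf u b → ChildOf u c → b Fin.< c → Separated b c
  siblings-separated {u} {b} {c} bu cu b<c =
    lo (rangeOf c) , scale (rangeOf c) , scale-positive (rangeOf c) (range-valid c) ,
    (λ v i → flat v (proj₂ (edge-∋ {v = v} i))) , (λ v i → proj₁ (edge-∋ {v = v} i))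
    where
    open ≤-Reasoning
    R = rangeOf u
    k = size u ∸ 1

    same-scale : scale (rangeOf b) ≡ scale (rangeOf c)
    same-scale = trans (cong scale (range-child bu)) (sym (cong scale (range-child cu)))

    hi≤lo : lo (rangeOf b) + width (rangeOf b) ≤ lo (rangeOf c)
    hi≤lo = begin
      lo (rangeOf b) + width (rangeOf b)                      ≡⟨ cong (λ R → lo R + width R) (range-child bu) ⟩
      lo R * k + width R * offset b + width R * size b        ≡⟨ +-assoc (lo R * k) _ _ ⟩
      lo R * k + (width R * offset b + width R * size b)      ≡⟨ cong (λ t → lo R * k + t) (*-distribˡ-+ (width R) (offset b) (size b)) ⟨
      lo R * k + width R * (offset b + size b)                ≤⟨ +-monoʳ-≤ (lo R * k) (*-monoʳ-≤ (width R) (offset-mono bu cu b<c)) ⟩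
      lo R * k + width R * offset c                           ≡⟨ cong lo (range-child cu) ⟨
      lo (rangeOf c)                                          ∎

    flat : ∀ v → Flatter (lo (rangeOf b) + width (rangeOf b)) (scale (rangeOf b)) (edge v) →
           Flatter (lo (rangeOf c)) (scale (rangeOf c)) (edge v)
    flat v f = subst (λ N → N * proj₂ (edge v) < lo (rangeOf c) * proj₁ (edge v)) same-scale
      (<-≤-trans f (*-monoˡ-≤ (proj₁ (edge v)) hi≤lo))

  height : ℤ → ℤ → Fin n → ℤ
  height a b v = + X v ℤ.* a ℤ.+ + Y v ℤ.* b

  -- The inner product with (- p , q), which is normal to the slope p / q.
  level : ℕ → ℕ → Fin n → ℤ
  level p q = height (ℤ.- + p) (+ q)

  -- The sign of the increment tells whether the edge is steeper or flatter than `p / q`.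
  level-child : ∀ p q {u c} → ChildOf u c →
                level p q c ≡ level p q u ℤ.+ (+ (q * proj₂ (edge c)) ℤ.- + (p * proj₁ (edge c)))
  level-child p q {u} {c} cu
    rewrite coordinate-child proj₁ cu | coordinate-child proj₂ cu
          | ℤ.pos-+ (X u) (proj₁ (edge c)) | ℤ.pos-+ (Y u) (proj₂ (edge c))
          | ℤ.pos-* q (proj₂ (edge c)) | ℤ.pos-* p (proj₁ (edge c)) =
    lemma (+ X u) (+ Y u) (+ proj₁ (edge c)) (+ proj₂ (edge c)) (+ p) (+ q)
    where
    lemma : ∀ X Y x y p q → (X ℤ.+ x) ℤ.* ℤ.- p ℤ.+ (Y ℤ.+ y) ℤ.* q
                          ≡ X ℤ.* ℤ.- p ℤ.+ Y ℤ.* q ℤ.+ (q ℤ.* y ℤ.- p ℤ.* x)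
    lemma = ℤ.solve-∀

  level-rises : ∀ p q {u c} → ChildOf u c → Steeper p q (edge c) → level p q u ℤ.< level p q c
  level-rises p q {u} {c} cu s = subst₂ ℤ._<_ (ℤ.+-identityʳ _) (sym (level-child p q cu))
    (ℤ.+-monoʳ-< (level p q u) (i<j⇒0<j-i (ℤ.+<+ s)))

  level-falls : ∀ p q {u c} → ChildOf u c → Flatter p q (edge c) → level p q c ℤ.< level p q u
  level-falls p q {u} {c} cu s = subst₂ ℤ._<_ (sym (level-child p q cu)) (ℤ.+-identityʳ _)
    (ℤ.+-monoʳ-< (level p q u) (i<j⇒i-j<0 (ℤ.+<+ s)))

  -- Shapes of paths and their monotonicity.

  Down : Fin n → Fin n → Fin n → Set
  Down b u c = ChildOf u c × b ∈ anc c

  linked-step : ∀ {R : Fin n → Fin n → Set} {u v w p} → R u v → Path v w p → Linked R p → Linked R (u ∷ p)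
  linked-step uv stop         l = uv ∷ l
  linked-step uv (step _ _ _) l = uv ∷ l

  -- A path that has made a step down cannot turn: it would return to the parent it came from.
  descend : ∀ {z b u w p} → Path u w p → ChildOf z u → z ∉ p → b ∈ anc u → Linked (Down b) p
  descend stop cz z∉ i = [-]
  descend (step a π u∉) cz z∉ i with child-of-adj a
  ... | inj₁ cu = linked-step (cu , j) π (descend π cu u∉ j)
    where j = anc-trans i (parent∈ cu)
  ... | inj₂ cv with refl ← parent-unique cz cv = contradiction (there (start∈ π)) z∉

  -- In `turning`, `z` is the highest vertex, entered from its child `a` and left towards its child
  -- `b`. In `descending`, `b ∈ p` is kept so that prepending a step up from a child `a` of `u`
  -- yields `a ≢ b` by simplicity.
  data Shape (u : Fin n) (p : List (Fin n)) : Set where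
    ascending  : Linked (flip ChildOf) p → Shape u p
    descending : ∀ {b} → ChildOf u b → b ∈ p → Linked (Down b) p → Shape u p
    turning    : ∀ {z a b} → ChildOf z a → ChildOf z b → a ≢ b → a ∈ anc u →
                 Linked (λ x y → Down a y x ⊎ Down b x y) p → Shape u p

  shape : ∀ {u w p} → Path u w p → Shape u p
  shape stop = ascending [-]
  shape (step {v = v} a π u∉) with child-of-adj a
  ... | inj₁ cu = descending cu (there (start∈ π))
                    (linked-step (cu , self∈ v) π (descend π cu u∉ (self∈ v)))
  ... | inj₂ cv with shape π
  ...   | ascending l = ascending (linked-step cv π l)
  ...   | descending {b} cb i l = turning cv cb (λ { refl → u∉ i }) (self∈ _)
                                    (linked-step (inj₁ (cv , self∈ _)) π (Linked.map inj₂ l))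
  ...   | turning ca cb a≢b i l = turning ca cb a≢b j (linked-step (inj₁ (cv , j)) π l)
    where j = anc-trans i (parent∈ cv)

  -- Falling levels count too: they rise in the opposite direction (p , - q).
  Monotone : List (Fin n) → Set
  Monotone l = ∃[ p ] ∃[ q ] 0 < q × (Linked (λ x y → level p q x ℤ.< level p q y) l
                                    ⊎ Linked (λ x y → level p q y ℤ.< level p q x) l)

  -- Edges below `a` lose level downwards but are climbed, and edges below `b` gain level and are
  -- descended, so the level rises on both sides of the turn.
  turn-rises : ∀ {a b l} → Separated a b → Linked (λ x y → Down a y x ⊎ Down b x y) l → Monotone l
  turn-rises (p , q , q>0 , flat , steep) l = p , q , q>0 , inj₁ (Linked.map
    (λ { {x} {y} (inj₁ (c , i)) → level-falls p q c (flat x i)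
       ; {x} {y} (inj₂ (c , i)) → level-rises p q c (steep y i) }) l)

  turn-falls : ∀ {a b l} → Separated b a → Linked (λ x y → Down a y x ⊎ Down b x y) l → Monotone l
  turn-falls (p , q , q>0 , flat , steep) l = p , q , q>0 , inj₂ (Linked.map
    (λ { {x} {y} (inj₁ (c , i)) → level-rises p q c (steep x i)
       ; {x} {y} (inj₂ (c , i)) → level-falls p q c (flat y i) }) l)

  shape⇒monotone : ∀ {u l} → Shape u l → Monotone l
  -- For `p = 0` and `q = 1` the level is the ordinate, and the second component of every `edgeIn`
  -- is a successor, whence `z<s`.
  shape⇒monotone (ascending l) = 0 , 1 , z<s , inj₂ (Linked.map (λ c → level-rises 0 1 c z<s) l)
  shape⇒monotone (descending _ _ l) = 0 , 1 , z<s , inj₁ (Linked.map (λ (c , _) → level-rises 0 1 c z<s) l)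
  shape⇒monotone (turning {a = a} {b} ca cb a≢b _ l) = by (<-cmp a b)
    where
    -- The order of the two siblings as elements of `Fin n` decides which range lies lower, hence
    -- whether the level rises or falls.
    by : Tri (a Fin.< b) (a ≡ b) (b Fin.< a) → Monotone _
    by (tri< a<b _ _) = turn-rises (siblings-separated ca cb a<b) l
    by (tri≈ _ a≡b _) = contradiction a≡b a≢b
    by (tri> _ _ b<a) = turn-falls (siblings-separated cb ca b<a) l

  monotone : ∀ {u w l} → Path u w l → Monotone l
  monotone π = shape⇒monotone (shape π)

-- The embedding of the integers into the rationals.

fromℤ-toℚᵘ : ∀ z → ℚ.toℚᵘ (fromℤ z) ℚᵘ.≃ mkℚᵘ z 0
fromℤ-toℚᵘ z = ℚ.toℚᵘ-fromℚᵘ (mkℚᵘ z 0)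

-- Normalisation keeps `z / 1` from computing for a variable `z`, so the law is checked among
-- unnormalised rationals, where both sides are explicit.
fromℤ-+ : ∀ a b → fromℤ (a ℤ.+ b) ≡ fromℤ a ℚ.+ fromℤ b
fromℤ-+ a b = ℚ.toℚᵘ-injective (begin
  ℚ.toℚᵘ (fromℤ (a ℤ.+ b))                      ≈⟨ fromℤ-toℚᵘ (a ℤ.+ b) ⟩
  mkℚᵘ (a ℤ.+ b) 0                              ≡⟨ cong (λ z → mkℚᵘ z 0) (cong₂ ℤ._+_ (ℤ.*-identityʳ a) (ℤ.*-identityʳ b)) ⟨
  mkℚᵘ a 0 ℚᵘ.+ mkℚᵘ b 0                        ≈⟨ ℚᵘ.+-cong (fromℤ-toℚᵘ a) (fromℤ-toℚᵘ b) ⟨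
  ℚ.toℚᵘ (fromℤ a) ℚᵘ.+ ℚ.toℚᵘ (fromℤ b)        ≈⟨ ℚ.toℚᵘ-homo-+ (fromℤ a) (fromℤ b) ⟨
  ℚ.toℚᵘ (fromℤ a ℚ.+ fromℤ b)                  ∎)
  where open ℚᵘ.≃-Reasoning

fromℤ-* : ∀ a b → fromℤ (a ℤ.* b) ≡ fromℤ a ℚ.* fromℤ b
fromℤ-* a b = ℚ.toℚᵘ-injective (begin
  ℚ.toℚᵘ (fromℤ (a ℤ.* b))                      ≈⟨ fromℤ-toℚᵘ (a ℤ.* b) ⟩
  mkℚᵘ a 0 ℚᵘ.* mkℚᵘ b 0                        ≈⟨ ℚᵘ.*-cong (fromℤ-toℚᵘ a) (fromℤ-toℚᵘ b) ⟨
  ℚ.toℚᵘ (fromℤ a) ℚᵘ.* ℚ.toℚᵘ (fromℤ b)        ≈⟨ ℚ.toℚᵘ-homo-* (fromℤ a) (fromℤ b) ⟨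
  ℚ.toℚᵘ (fromℤ a ℚ.* fromℤ b)                  ∎)
  where open ℚᵘ.≃-Reasoning

fromℤ-mono-< : ∀ {a b} → a ℤ.< b → fromℤ a ℚ.< fromℤ b
fromℤ-mono-< {a} {b} a<b = ℚ.toℚᵘ-cancel-<
  (ℚᵘ.<-respˡ-≃ (ℚᵘ.≃-sym (fromℤ-toℚᵘ a)) (ℚᵘ.<-respʳ-≃ (ℚᵘ.≃-sym (fromℤ-toℚᵘ b))
    (*<* (subst₂ ℤ._<_ (sym (ℤ.*-identityʳ a)) (sym (ℤ.*-identityʳ b)) a<b))))

fromℤ-mono-≤ : ∀ {a b} → a ℤ.≤ b → fromℤ a ℚ.≤ fromℤ b
fromℤ-mono-≤ {a} {b} a≤b = ℚ.toℚᵘ-cancel-≤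
  (ℚᵘ.≤-respˡ-≃ (ℚᵘ.≃-sym (fromℤ-toℚᵘ a)) (ℚᵘ.≤-respʳ-≃ (ℚᵘ.≃-sym (fromℤ-toℚᵘ b))
    (*≤* (subst₂ ℤ._≤_ (sym (ℤ.*-identityʳ a)) (sym (ℤ.*-identityʳ b)) a≤b))))

-- Points of segments and linear functionals on them.

lerp : ℚ → ℚ → ℚ → ℚ
lerp t a b = (1ℚ ℚ.- t) ℚ.* a ℚ.+ t ℚ.* b

lerp-const : ∀ t a → lerp t a a ≡ a
lerp-const = solve 2 (λ t a → (con 1ℚ :- t) :* a :+ t :* a := a) refl
  where open +-*-Solver

lerp-1 : ∀ a b → lerp 1ℚ a b ≡ b
lerp-1 = solve 2 (λ a b → (con 1ℚ :- con 1ℚ) :* a :+ con 1ℚ :* b := b) refl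
  where open +-*-Solver

lerp-flip : ∀ t a b → lerp t a b ≡ lerp (1ℚ ℚ.- t) b a
lerp-flip = solve 3 (λ t a b → (con 1ℚ :- t) :* a :+ t :* b :=
  (con 1ℚ :- (con 1ℚ :- t)) :* b :+ (con 1ℚ :- t) :* a) refl
  where open +-*-Solver

lerp-⟨∣⟩ : ∀ t (P Q : Point) (d : Vector) →
           ⟨ (lerp t (proj₁ P) (proj₁ Q) , lerp t (proj₂ P) (proj₂ Q)) ∣ d ⟩ ≡ lerp t ⟨ P ∣ d ⟩ ⟨ Q ∣ d ⟩
lerp-⟨∣⟩ t (px , py) (qx , qy) (a , b) = solve 7 (λ t px py qx qy a b →
  ((con 1ℚ :- t) :* px :+ t :* qx) :* a :+ ((con 1ℚ :- t) :* py :+ t :* qy) :* b :=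
  (con 1ℚ :- t) :* (px :* a :+ py :* b) :+ t :* (qx :* a :+ qy :* b)) refl t px py qx qy a b
  where open +-*-Solver

0≤1-t : ∀ {t} → t ℚ.≤ 1ℚ → 0ℚ ℚ.≤ 1ℚ ℚ.- t
0≤1-t {t} t≤1 = subst (ℚ._≤ 1ℚ ℚ.- t) (ℚ.+-inverseʳ t) (ℚ.+-monoˡ-≤ (ℚ.- t) t≤1)

1-t≤1 : ∀ {t} → 0ℚ ℚ.≤ t → 1ℚ ℚ.- t ℚ.≤ 1ℚ
1-t≤1 {t} 0≤t = subst (1ℚ ℚ.- t ℚ.≤_) (ℚ.+-identityʳ 1ℚ) (ℚ.+-monoʳ-≤ 1ℚ (ℚ.neg-antimono-≤ 0≤t))

lerp-mono : ∀ {t a a′ b b′} → 0ℚ ℚ.≤ t → t ℚ.≤ 1ℚ → a ℚ.≤ a′ → b ℚ.≤ b′ → lerp t a b ℚ.≤ lerp t a′ b′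
lerp-mono {t} 0≤t t≤1 a≤a′ b≤b′ = ℚ.+-mono-≤
  (ℚ.*-monoˡ-≤-nonNeg (1ℚ ℚ.- t) {{ℚ.nonNegative (0≤1-t t≤1)}} a≤a′)
  (ℚ.*-monoˡ-≤-nonNeg t {{ℚ.nonNegative 0≤t}} b≤b′)

lerp-≥ : ∀ {t a b c} → 0ℚ ℚ.≤ t → t ℚ.≤ 1ℚ → c ℚ.≤ a → c ℚ.≤ b → c ℚ.≤ lerp t a b
lerp-≥ {t} {c = c} 0≤t t≤1 c≤a c≤b = subst (ℚ._≤ _) (lerp-const t c) (lerp-mono 0≤t t≤1 c≤a c≤b)

lerp-≤ : ∀ {t a b c} → 0ℚ ℚ.≤ t → t ℚ.≤ 1ℚ → a ℚ.≤ c → b ℚ.≤ c → lerp t a b ℚ.≤ c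
lerp-≤ {t} {c = c} 0≤t t≤1 a≤c b≤c = subst (_ ℚ.≤_) (lerp-const t c) (lerp-mono 0≤t t≤1 a≤c b≤c)

lerp-< : ∀ {t a b} → t ℚ.< 1ℚ → a ℚ.< b → lerp t a b ℚ.< b
lerp-< {t} {a} {b} t<1 a<b = subst (lerp t a b ℚ.<_) (lerp-const t b)
  (ℚ.+-monoˡ-< (t ℚ.* b) (ℚ.*-monoʳ-<-pos (1ℚ ℚ.- t) {{ℚ.positive 0<1-t}} a<b))
  where
  0<1-t : 0ℚ ℚ.< 1ℚ ℚ.- t
  0<1-t = subst (ℚ._< 1ℚ ℚ.- t) (ℚ.+-inverseʳ t) (ℚ.+-monoˡ-< (ℚ.- t) t<1)

module _ {P Q X : Point} where

  segment-sym : X ∈[ P , Q ] → X ∈[ Q , P ]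
  segment-sym (t , 0≤t , t≤1 , refl) =
    1ℚ ℚ.- t , 0≤1-t t≤1 , 1-t≤1 0≤t , cong₂ _,_ (lerp-flip t _ _) (lerp-flip t _ _)

  segment-≥ : ∀ d {c} → X ∈[ P , Q ] → c ℚ.≤ ⟨ P ∣ d ⟩ → c ℚ.≤ ⟨ Q ∣ d ⟩ → c ℚ.≤ ⟨ X ∣ d ⟩
  segment-≥ d (t , 0≤t , t≤1 , refl) c≤P c≤Q =
    subst (_ ℚ.≤_) (sym (lerp-⟨∣⟩ t P Q d)) (lerp-≥ 0≤t t≤1 c≤P c≤Q)

  segment-≤ : ∀ d {c} → X ∈[ P , Q ] → ⟨ P ∣ d ⟩ ℚ.≤ c → ⟨ Q ∣ d ⟩ ℚ.≤ c → ⟨ X ∣ d ⟩ ℚ.≤ c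
  segment-≤ d (t , 0≤t , t≤1 , refl) P≤c Q≤c =
    subst (ℚ._≤ _) (sym (lerp-⟨∣⟩ t P Q d)) (lerp-≤ 0≤t t≤1 P≤c Q≤c)

  -- A functional that increases from `P` to `Q` stays strictly below its value at `Q` for all
  -- parameters below 1.
  segment-end : ∀ d → X ∈[ P , Q ] → ⟨ P ∣ d ⟩ ℚ.< ⟨ Q ∣ d ⟩ → ⟨ Q ∣ d ⟩ ℚ.≤ ⟨ X ∣ d ⟩ → X ≡ Q
  segment-end d (t , 0≤t , t≤1 , refl) P<Q Q≤X with ℚ.<-cmp t 1ℚ
  ... | tri≈ _ refl _ = cong₂ _,_ (lerp-1 (proj₁ P) _) (lerp-1 (proj₂ P) _)
  ... | tri> _ _ 1<t  = contradiction (ℚ.<-≤-trans 1<t t≤1) (ℚ.<-irrefl refl)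
  ... | tri< t<1 _ _  = contradiction
    (ℚ.≤-<-trans Q≤X (subst (ℚ._< ⟨ Q ∣ d ⟩) (sym (lerp-⟨∣⟩ t P Q d)) (lerp-< t<1 P<Q)))
    (ℚ.<-irrefl refl)

-- From monotone paths to a drawing without crossings.

allPairs-last : ∀ {A : Set} {R : A → A → Set} {c d} ps → AllPairs R (ps ++ c ∷ d ∷ []) → R c d
allPairs-last []       ((cd All.∷ _) ∷ _) = cd
allPairs-last (_ ∷ ps) (_ ∷ l)            = allPairs-last ps l

-- `MonotonePath` for a bare position map: monotonicity is used to prove the fields of `Drawing`,
-- before a drawing exists.
Monotonic : ∀ {n} → (Fin n → Point) → List (Fin n) → Set
Monotonic pos p = ∃[ d ] d ≢ (0ℚ , 0ℚ) × AllPairs (λ x y → ⟨ pos x ∣ d ⟩ ℚ.< ⟨ pos y ∣ d ⟩) p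

module MonotoneDrawing {n : ℕ} (T : Tree n) (pos : Fin n → Point)
  (monotone : ∀ {u w p} → Paths.Path T u w p → Monotonic pos p) where
  open Tree T
  open Paths T

  distinct : ∀ {u v} → pos u ≡ pos v → u ≡ v
  distinct {u} {v} eq = equal (proj₂ (path u v))
    where
    equal : ∀ {p} → Path u v p → u ≡ v
    equal stop           = refl
    equal π@(step _ ρ _) = apart (monotone π)
      where
      apart : Monotonic pos (u ∷ _) → u ≡ v
      apart (d , _ , us ∷ _) =
        contradiction (All.lookup us (end∈ ρ)) (ℚ.<-irrefl (cong (λ P → ⟨ P ∣ d ⟩) eq))

  -- Along a direction in which the whole path increases, the first edge ends no later than the last
  -- one begins, so two different edges can touch only where `b` and `c` coincide.
  meet : ∀ {u w a b c d qs X} ps → Path u w (a ∷ b ∷ qs) → a ∷ b ∷ qs ≡ ps ++ c ∷ d ∷ [] →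
         X ∈[ pos a , pos b ] → X ∈[ pos c , pos d ] →
         (a ≡ c × b ≡ d) ⊎ (b ≡ c × X ≡ pos b)
  meet [] _ refl _ _ = inj₁ (refl , refl)
  meet {a = a} {b} {c} {d} {X = X} (_ ∷ ps′) π eq X∈ab X∈cd = inj₂ (increasing ps′ (monotone π) eq)
    where
    increasing : ∀ {a′ qs} ps → Monotonic pos (a ∷ b ∷ qs) →
                 a ∷ b ∷ qs ≡ (a′ ∷ ps) ++ c ∷ d ∷ [] → b ≡ c × X ≡ pos b
    increasing [] (e , _ , (ab All.∷ _) ∷ (bd All.∷ _) ∷ _) refl =
      refl , segment-end e X∈ab ab (segment-≥ e X∈cd ℚ.≤-refl (ℚ.<⇒≤ bd))
    -- Here `b` strictly precedes `c`, so `X` would lie both at or before `b` and at or after `c`.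
    increasing (_ ∷ ps) (e , _ , (ab All.∷ _) ∷ bs ∷ l) refl = contradiction
      (ℚ.≤-<-trans (segment-≤ e X∈ab (ℚ.<⇒≤ ab) ℚ.≤-refl)
        (ℚ.<-≤-trans (All.lookup bs (∈-++⁺ʳ ps (here refl)))
          (segment-≥ e X∈cd ℚ.≤-refl (ℚ.<⇒≤ (allPairs-last ps l)))))
      (ℚ.<-irrefl refl)

  data Ends (u v : Fin n) : Fin n → Fin n → Set where
    forward  : Ends u v u v
    backward : Ends u v v u

  orient : ∀ {u v a b X} → Ends u v a b → X ∈[ pos u , pos v ] → X ∈[ pos a , pos b ]
  orient forward X∈ = X∈
  orient backward X∈ = segment-sym X∈

  ends-equal : ∀ {u v x y a b} → Ends u v a b → Ends x y a b → (u ≡ x × v ≡ y) ⊎ (u ≡ y × v ≡ x)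
  ends-equal forward forward = inj₁ (refl , refl)
  ends-equal forward backward = inj₂ (refl , refl)
  ends-equal backward forward = inj₂ (refl , refl)
  ends-equal backward backward = inj₁ (refl , refl)

  first∈ : ∀ {u v a b} → Ends u v a b → a ≡ u ⊎ a ≡ v
  first∈ forward = inj₁ refl
  first∈ backward = inj₂ refl

  second∈ : ∀ {u v a b} → Ends u v a b → b ≡ u ⊎ b ≡ v
  second∈ forward = inj₂ refl
  second∈ backward = inj₁ refl

  -- The path from `u` to `x` either leaves along the given edge or can be preceded by it, traversed
  -- from `v` to `u`.
  start-with : ∀ {u v x} → Adj u v → ∃[ a ] ∃[ b ] ∃[ q ] Ends u v a b × Path a x (a ∷ b ∷ q)
  start-with {u} {v} {x} a with _ , π ← path u x with extendˡ π a
  ... | inj₁ (q , eq) = u , v , q , forward , subst (Path u x) eq π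
  ... | inj₂ ρ with q , eq ← path-cons π = v , u , q , backward , subst (λ p → Path v x (v ∷ p)) eq ρ

  noCrossing : ∀ {u v x y X} → Adj u v → Adj x y →
               X ∈[ pos u , pos v ] → X ∈[ pos x , pos y ] →
               ((u ≡ x × v ≡ y) ⊎ (u ≡ y × v ≡ x)) ⊎
               (∃[ z ] (z ≡ u ⊎ z ≡ v) × (z ≡ x ⊎ z ≡ y) × X ≡ pos z)
  noCrossing {u} {v} {x} {y} {X} uv xy X∈uv X∈xy with a , b , q , ab , π ← start-with {x = x} uv
    = both (extendʳ π xy)
    where
    finish : ∀ {c d} → Ends x y c d → (a ≡ c × b ≡ d) ⊎ (b ≡ c × X ≡ pos b) →
             ((u ≡ x × v ≡ y) ⊎ (u ≡ y × v ≡ x)) ⊎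
             (∃[ z ] (z ≡ u ⊎ z ≡ v) × (z ≡ x ⊎ z ≡ y) × X ≡ pos z)
    finish cd (inj₁ (refl , refl)) = inj₁ (ends-equal ab cd)
    finish cd (inj₂ (refl , eq))   = inj₂ (b , second∈ ab , first∈ cd , eq)

    both : (∃[ ps ] a ∷ b ∷ q ≡ ps ++ y ∷ x ∷ []) ⊎ Path a y (a ∷ b ∷ q ∷ʳ y) →
           ((u ≡ x × v ≡ y) ⊎ (u ≡ y × v ≡ x)) ⊎
           (∃[ z ] (z ≡ u ⊎ z ≡ v) × (z ≡ x ⊎ z ≡ y) × X ≡ pos z)
    both (inj₁ (ps , eq)) = finish backward (meet ps π eq (orient ab X∈uv) (segment-sym X∈xy))
    both (inj₂ ρ) with ps , eq ← path-snoc π =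
      finish forward (meet ps ρ (trans (cong (_∷ʳ y) eq) (++-assoc ps (x ∷ []) (y ∷ []))) (orient ab X∈uv) X∈xy)

-- The drawing on the integer grid.

module GridDrawing {n : ℕ} (T : Tree n) (r : Fin n) where
  open Tree T
  open Paths T
  open Rooted T r

  pos : Fin n → Point
  pos v = fromℤ (+ X v) , fromℤ (+ Y v)

  direction : ℤ → ℤ → Vector
  direction a b = fromℤ a , fromℤ b

  height-pos : ∀ a b v → fromℤ (height a b v) ≡ ⟨ pos v ∣ direction a b ⟩
  height-pos a b v = trans (fromℤ-+ (+ X v ℤ.* a) (+ Y v ℤ.* b)) (cong₂ ℚ._+_ (fromℤ-* (+ X v) a) (fromℤ-* (+ Y v) b))

  heights-monotonic : ∀ {a b l} → fromℤ b ≢ 0ℚ → Linked (λ x y → height a b x ℤ.< height a b y) l → Monotonic pos l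
  heights-monotonic {a} {b} b≢0 l =
    direction a b , (λ eq → b≢0 (cong proj₂ eq)) ,
    Linked⇒AllPairs ℚ.<-trans
      (Linked.map (λ {x} {y} x<y → subst₂ ℚ._<_ (height-pos a b x) (height-pos a b y) (fromℤ-mono-< x<y)) l)

  height-neg : ∀ a b v → ℤ.- height a b v ≡ height (ℤ.- a) (ℤ.- b) v
  height-neg a b v = lemma (+ X v) (+ Y v) a b
    where
    lemma : ∀ X Y a b → ℤ.- (X ℤ.* a ℤ.+ Y ℤ.* b) ≡ X ℤ.* ℤ.- a ℤ.+ Y ℤ.* ℤ.- b
    lemma = ℤ.solve-∀

  monotone⇒monotonic : ∀ {l} → Monotone l → Monotonic pos l
  monotone⇒monotonic (p , q , q>0 , inj₁ l) =
    heights-monotonic (≢-sym (ℚ.<⇒≢ (fromℤ-mono-< (ℤ.+<+ q>0)))) l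
  monotone⇒monotonic (p , q , q>0 , inj₂ l) =
    -- The direction (- p , q) is negated to turn falling levels into rising ones; the double
    -- negation has the form that `height-neg` produces.
    heights-monotonic {ℤ.- ℤ.- + p} (ℚ.<⇒≢ (fromℤ-mono-< (ℤ.neg-mono-< (ℤ.+<+ q>0))))
      (Linked.map (λ {x} {y} y<x → subst₂ ℤ._<_ (height-neg (ℤ.- + p) (+ q) x) (height-neg (ℤ.- + p) (+ q) y) (ℤ.neg-mono-< y<x)) l)

  pos-monotonic : ∀ {u w l} → Path u w l → Monotonic pos l
  pos-monotonic π = monotone⇒monotonic (monotone π)

  drawing : Drawing T
  drawing = record { pos = pos ; distinct = distinct ; noCrossing = noCrossing }
    where open MonotoneDrawing T pos pos-monotonic

  square : Rectangle
  square = record { left = + 0 ; right = + (12 * n) ; bottom = + 0 ; top = + (12 * n) }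

  inside : ∀ k → k ℕ.≤ 2 * n → fromℤ (+ 0) ℚ.≤ fromℤ (+ k) × fromℤ (+ k) ℚ.≤ fromℤ (+ (12 * n))
  inside k k≤2n = fromℤ-mono-≤ {+ 0} {+ k} (ℤ.+≤+ ℕ.z≤n) ,
    fromℤ-mono-≤ {+ k} (ℤ.+≤+ (ℕ.≤-trans k≤2n (ℕ.*-monoˡ-≤ n {2} {12} (ℕ.s≤s (ℕ.s≤s ℕ.z≤n)))))

  X-inside : ∀ v → fromℤ (+ 0) ℚ.≤ fromℤ (+ X v) × fromℤ (+ X v) ℚ.≤ fromℤ (+ (12 * n))
  X-inside v = inside (X v) (X≤2n v)

  Y-inside : ∀ v → fromℤ (+ 0) ℚ.≤ fromℤ (+ Y v) × fromℤ (+ Y v) ℚ.≤ fromℤ (+ (12 * n))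
  Y-inside v = inside (Y v) (ℕ.≤-trans (Y≤X v) (X≤2n v))

  contained : ContainedIn T drawing square
  contained (inj₁ (u , refl)) = X-inside u , Y-inside u
  contained (inj₂ (u , v , _ , t , 0≤t , t≤1 , refl)) =
    within (X-inside u) (X-inside v) , within (Y-inside u) (Y-inside v)
    where
    -- An interval is convex, so the bounds at the ends of an edge pass to all its points.
    within : ∀ {a b lo hi} → lo ℚ.≤ a × a ℚ.≤ hi → lo ℚ.≤ b × b ℚ.≤ hi → lo ℚ.≤ lerp t a b × lerp t a b ℚ.≤ hi
    within (lo≤a , a≤hi) (lo≤b , b≤hi) = lerp-≥ 0≤t t≤1 lo≤a lo≤b , lerp-≤ 0≤t t≤1 a≤hi b≤hi

open import Data.Integer using (_≤_)

corollary1 : (n : ℕ) (T : Tree n) →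
    ∃[ D ] IsMonotone T D × OnGrid T D ×
    (∃[ R ] ContainedIn T D R ×
    Rectangle.width R ≤ + (12 * n) × Rectangle.height R ≤ + (12 * n))
corollary1 n T =
  drawing , (λ π → pos-monotonic (Paths.fromIsPath T π)) , (λ u → (+ X u , refl) , (+ Y u , refl)) ,
  square , contained , side , side
  where
  -- Any vertex can be the root; the tree is nonempty, so vertex 0 exists.
  root : Fin n
  root = Fin.fromℕ< (ℕ.>-nonZero⁻¹ n {{Tree.nonEmpty T}})

  open GridDrawing T root
  open Rooted T root using (X; Y)

  side : + (12 * n) ℤ.- + 0 ≤ + (12 * n)
  side = ℤ.≤-reflexive (ℤ.+-identityʳ _)
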